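{- If $G$ is a tree with $\operatorname{diam}(G) \leq 5$, then the $r$-independence complex $\mathrm{Ind}_r(G)$ is shellable for all integers $r \geq 2$.
   Context: $\operatorname{diam}(G)$ is the maximum over pairs of vertices of the length of a shortest path between them. For $r \geq 1$, a subset $A \subseteq V(G)$ is $r$-independent if every connected component of the induced subgraph $G[A]$ has at most $r$ vertices; $\mathrm{Ind}_r(G)$ is the simplicial complex on $V(G)$ of all $r$-independent subsets. A (not necessarily pure) simplicial complex is shellable if its facets can be ordered $F_1,\dots,F_t$ so that for each $k>1$, $\langle F_k\rangle \cap \langle F_1,\dots,F_{k-1}\rangle$ is pure of dimension $\dim F_k-1$ ($\langle\mathcal F\rangle$ = complex generated by $\mathcal F$). -}

module Defs where

open import Data.Nat using (ℕ; zero; suc; _+_; _≤_)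
open import Data.Bool using (Bool; true; false; T)
open import Data.Fin using (Fin)
open import Data.Fin.Subset using (Subset; _∈_; _⊆_; ∣_∣)
open import Data.List using (List; []; _∷_; length; _++_; last)
open import Data.List.Relation.Unary.All using (All)
open import Data.List.Relation.Unary.Any using (Any)
open import Data.List.Relation.Unary.Unique.Propositional using (Unique)
import Data.List.Membership.Propositional as LM
open import Data.Product using (Σ; ∃; ∃-syntax; _×_; _,_)
open import Data.Maybe using (Maybe; just; nothing)
open import Relation.Nullary using (¬_)
open import Relation.Binary.PropositionalEquality using (_≡_; _≢_)
open import Function.Bundles using (_⇔_)

record Graph (n : ℕ) : Set where
  field
    adj    : Fin n → Fin n → Bool
    sym    : ∀ u v → adj u v ≡ adj v u
    irrefl : ∀ u → adj u u ≡ false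

open Graph public

Adj : ∀ {n} → Graph n → Fin n → Fin n → Set
Adj G u v = T (adj G u v)

-- Walks of length k from u to v whose vertices all satisfy P
-- (P = everything: walks in G;  P = membership in A: walks in G[A]).
data WalkIn {n} (G : Graph n) (P : Fin n → Set) : Fin n → Fin n → ℕ → Set where
  nil  : ∀ {u} → P u → WalkIn G P u u zero
  cons : ∀ {u w v k} → P u → Adj G u w → WalkIn G P w v k → WalkIn G P u v (suc k)

Everything : ∀ {n} → Fin n → Set
Everything _ = Data.Bool.T true
  where import Data.Bool

Walk : ∀ {n} → Graph n → Fin n → Fin n → ℕ → Set
Walk G = WalkIn G Everything

Connected : ∀ {n} → Graph n → Set
Connected G = ∀ u v → ∃[ k ] Walk G u v k

Chain : ∀ {n} → Graph n → List (Fin n) → Set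
Chain G []           = Data.Bool.T true
  where import Data.Bool
Chain G (x ∷ [])     = Data.Bool.T true
  where import Data.Bool
Chain G (x ∷ y ∷ xs) = Adj G x y × Chain G (y ∷ xs)

IsCycle : ∀ {n} → Graph n → List (Fin n) → Set
IsCycle G []       = Data.Empty.⊥
  where import Data.Empty
IsCycle G (x ∷ xs) =
  3 ≤ length (x ∷ xs) × Unique (x ∷ xs) × Chain G (x ∷ xs) ×
  (∀ y → last (x ∷ xs) ≡ just y → Adj G y x)

Acyclic : ∀ {n} → Graph n → Set
Acyclic G = ∀ cs → ¬ IsCycle G cs

IsTree : ∀ {n} → Graph n → Set
IsTree {n} G = (1 ≤ n) × Connected G × Acyclic G

DiamLe : ∀ {n} → Graph n → ℕ → Set
DiamLe G d = ∀ u v → ∃[ k ] (k ≤ d × Walk G u v k)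

SameComponent : ∀ {n} → Graph n → Subset n → Fin n → Fin n → Set
SameComponent G A v w = ∃[ k ] WalkIn G (_∈ A) v w k

RIndependent : ∀ {n} → ℕ → Graph n → Subset n → Set
RIndependent r G A =
  ∀ v → v ∈ A → ∀ (ws : List _) → Unique ws →
  All (SameComponent G A v) ws → length ws ≤ r

-- Simplicial complexes on Fin n, given by their set of faces

Complex : ℕ → Set₁
Complex n = Subset n → Set

Ind : ∀ {n} → ℕ → Graph n → Complex n
Ind r G = RIndependent r G

IsFacet : ∀ {n} → Complex n → Subset n → Set
IsFacet Δ σ = Δ σ × (∀ τ → Δ τ → σ ⊆ τ → τ ⊆ σ)

Generated : ∀ {n} → List (Subset n) → Complex n
Generated Fs σ = Any (σ ⊆_) Fs

_∩ᶜ_ : ∀ {n} → Complex n → Complex n → Complex n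
(Δ ∩ᶜ Γ) σ = Δ σ × Γ σ

-- F₁,…,F_t is a shelling order: it lists every facet exactly once, and
-- for k > 1, ⟨F_k⟩ ∩ ⟨F₁,…,F_{k-1}⟩ is pure of dimension dim F_k − 1,
-- i.e. all its facets have ∣F_k∣ − 1 vertices.
IsShelling : ∀ {n} → Complex n → List (Subset n) → Set
IsShelling Δ Fs =
  Unique Fs ×
  (∀ F → IsFacet Δ F ⇔ F LM.∈ Fs) ×
  (∀ pre F post → Fs ≡ pre ++ F ∷ post → pre ≢ [] →
     ∀ σ → IsFacet (Generated (F ∷ []) ∩ᶜ Generated pre) σ →
       ∣ σ ∣ + 1 ≡ ∣ F ∣)

Shellable : ∀ {n} → Complex n → Set
Shellable Δ = ∃[ Fs ] IsShelling Δ Fs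

{-# OPTIONS --safe #-}
module Submission where

-- Root the tree and, for a vertex set A, let the branch of A at y be the set of
-- vertices joined to y by an ascending path inside A; A is r-independent iff all
-- its branches have at most r vertices. A shelling is obtained by vertex
-- decomposition of the complexes of r-independent sets between F and E. If E is
-- not r-independent, let y be a deepest vertex whose branch in E has more than r
-- vertices. If y ∉ F then y is a shedding vertex; otherwise the vertex w ∉ F with
-- the largest branch in E, among those in the branch of y, is one: w can be traded
-- for a missing vertex x of its own branch, and if there is none, for any
-- missing x in the branch of y, whose branch is at most as large as that of w.

open import Defs
open import Data.Bool using (T; true; false)
open import Data.Bool.Properties using (T?)
open import Data.Nat using (ℕ; zero; suc; _+_; _≤_; _<_; z≤n; s≤s; _≤?_)
import Data.Nat.Properties as ℕ
open import Data.Fin using (Fin; zero; suc; fromℕ<)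
open import Data.Fin.Properties using (any?; all?; _≟_; suc-injective; ¬∀⟶∃¬)
open import Data.Fin.Subset using (Subset; _∈_; _∉_; _⊆_; ∣_∣; _∪_; _∩_; _─_; _-_; ⁅_⁆; ⊥; ⊤)
open import Data.Fin.Subset.Properties
open import Data.List using (List; []; _∷_; _++_; length; last; map; filter; allFin)
open import Data.List.Properties using (∷-injective; length-map)
open import Data.List.Extrema.Nat using (argmax; argmax-all; f[xs]≤f[argmax])
open import Data.List.Relation.Unary.Any using (here; there)
open import Data.List.Relation.Unary.All using (All; []; _∷_)
import Data.List.Relation.Unary.All as All
import Data.List.Relation.Unary.All.Properties as All
open import Data.List.Relation.Unary.AllPairs using ([]; _∷_)
open import Data.List.Relation.Unary.Unique.Propositional using (Unique)
import Data.List.Relation.Unary.Unique.Propositional.Properties as Unique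
import Data.List.Membership.Propositional as List
import Data.List.Membership.DecPropositional as DecMembership
open import Data.List.Membership.Propositional using (find; lose)
open import Data.List.Membership.Propositional.Properties
  using (∈-++⁺ˡ; ∈-++⁺ʳ; ∈-++⁻; ∈-filter⁺; ∈-allFin)
open import Data.Maybe using (just)
open import Data.Maybe.Properties using (just-injective)
open import Data.Vec using ([]; _∷_; tabulate)
open import Data.Vec.Properties using (lookup∘tabulate; lookup⇒[]=; []=⇒lookup)
import Data.Vec as Vec
open import Data.Product using (∃; ∃-syntax; _×_; _,_; proj₁; proj₂)
open import Data.Sum using (_⊎_; inj₁; inj₂)
import Data.Sum as Sum
open import Data.Unit using (tt)
open import Function using (_∘_)
open import Function.Bundles using (mk⇔)
open import Relation.Nullary using (¬_; Dec; yes; no; does; ¬?; _×-dec_; contradiction)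
open import Relation.Nullary.Decidable using (decidable-stable; dec-true; map′)
open import Relation.Unary using (Decidable)
open import Relation.Binary.PropositionalEquality using (_≡_; _≢_; refl; trans; cong; subst)
  renaming (sym to ≡-sym)

private variable n : ℕ

-- Cardinalities of finite subsets.

x∈p─q⇒x∉q : ∀ (p q : Subset n) {x} → x ∈ p ─ q → x ∉ q
x∈p─q⇒x∉q (_ ∷ _) (true  ∷ _) () Vec.here
x∈p─q⇒x∉q (_ ∷ p) (_ ∷ q) (Vec.there x∈) (Vec.there x∈q) = x∈p─q⇒x∉q p q x∈ x∈q

x∈p-y⁻ : ∀ (p : Subset n) {x} y → x ∈ p - y → x ∈ p × x ≢ y
x∈p-y⁻ p y x∈ = p─q⊆p p ⁅ y ⁆ x∈ , λ { refl → x∈p─q⇒x∉q p ⁅ y ⁆ x∈ (x∈⁅x⁆ y) }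

∣p∪q∣+∣p∩q∣≡∣p∣+∣q∣ : ∀ (p q : Subset n) → ∣ p ∪ q ∣ + ∣ p ∩ q ∣ ≡ ∣ p ∣ + ∣ q ∣
∣p∪q∣+∣p∩q∣≡∣p∣+∣q∣ []          []          = refl
∣p∪q∣+∣p∩q∣≡∣p∣+∣q∣ (false ∷ p) (false ∷ q) = ∣p∪q∣+∣p∩q∣≡∣p∣+∣q∣ p q
∣p∪q∣+∣p∩q∣≡∣p∣+∣q∣ (true  ∷ p) (false ∷ q) = cong suc (∣p∪q∣+∣p∩q∣≡∣p∣+∣q∣ p q)
∣p∪q∣+∣p∩q∣≡∣p∣+∣q∣ (false ∷ p) (true  ∷ q) =
  trans (cong suc (∣p∪q∣+∣p∩q∣≡∣p∣+∣q∣ p q)) (≡-sym (ℕ.+-suc ∣ p ∣ ∣ q ∣))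
∣p∪q∣+∣p∩q∣≡∣p∣+∣q∣ (true  ∷ p) (true  ∷ q) = cong suc
  (trans (ℕ.+-suc _ _) (trans (cong suc (∣p∪q∣+∣p∩q∣≡∣p∣+∣q∣ p q)) (≡-sym (ℕ.+-suc ∣ p ∣ ∣ q ∣))))

∣p∪q∣≤∣p∣+∣q∣ : ∀ (p q : Subset n) → ∣ p ∪ q ∣ ≤ ∣ p ∣ + ∣ q ∣
∣p∪q∣≤∣p∣+∣q∣ p q = ℕ.≤-trans (ℕ.m≤m+n _ _) (ℕ.≤-reflexive (∣p∪q∣+∣p∩q∣≡∣p∣+∣q∣ p q))

disjoint⇒∣p∪q∣≡∣p∣+∣q∣ : ∀ (p q : Subset n) → (∀ {x} → x ∈ p → x ∉ q) → ∣ p ∪ q ∣ ≡ ∣ p ∣ + ∣ q ∣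
disjoint⇒∣p∪q∣≡∣p∣+∣q∣ {n} p q disjoint = trans (≡-sym (ℕ.+-identityʳ _))
  (trans (cong (∣ p ∪ q ∣ +_) (≡-sym ∣p∩q∣≡0)) (∣p∪q∣+∣p∩q∣≡∣p∣+∣q∣ p q))
  where
  ∣p∩q∣≡0 : ∣ p ∩ q ∣ ≡ 0
  ∣p∩q∣≡0 = trans (cong ∣_∣ (Empty-unique λ { (x , x∈) →
    let x∈p , x∈q = x∈p∩q⁻ p q x∈ in disjoint x∈p x∈q })) (∣⊥∣≡0 n)

_+ˢ_ : Subset n → Fin n → Subset n
A +ˢ x = A ∪ ⁅ x ⁆

x∈A+x : ∀ (A : Subset n) x → x ∈ A +ˢ x
x∈A+x A x = q⊆p∪q A ⁅ x ⁆ (x∈⁅x⁆ x)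

y∈A⇒y∈A+x : ∀ {A : Subset n} {x y} → y ∈ A → y ∈ A +ˢ x
y∈A⇒y∈A+x {x = x} = p⊆p∪q ⁅ x ⁆

y∈A+x⁻ : ∀ (A : Subset n) x {y} → y ∈ A +ˢ x → y ∈ A ⊎ y ≡ x
y∈A+x⁻ A x = Sum.map₂ (x∈⁅y⁆⇒x≡y x) ∘ x∈p∪q⁻ A ⁅ x ⁆

+ˢ-least : ∀ {A B : Subset n} {x} → A ⊆ B → x ∈ B → A +ˢ x ⊆ B
+ˢ-least {A = A} {x = x} A⊆B x∈B y∈ with y∈A+x⁻ A x y∈
... | inj₁ y∈A  = A⊆B y∈A
... | inj₂ refl = x∈B

∣A∣<∣A+x∣ : ∀ {A : Subset n} {x} → x ∉ A → ∣ A ∣ < ∣ A +ˢ x ∣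
∣A∣<∣A+x∣ {A = A} {x} x∉A = p⊂q⇒∣p∣<∣q∣ (p⊆p∪q ⁅ x ⁆ , x , x∈A+x A x , x∉A)

∣p-x∣+1≡∣p∣ : ∀ {p : Subset n} {x} → x ∈ p → ∣ p - x ∣ + 1 ≡ ∣ p ∣
∣p-x∣+1≡∣p∣ {p = p} {x} x∈p = trans (cong (∣ p - x ∣ +_) (≡-sym (∣⁅x⁆∣≡1 x)))
  (trans (≡-sym (disjoint⇒∣p∪q∣≡∣p∣+∣q∣ (p - x) ⁅ x ⁆ (x∈p─q⇒x∉q p ⁅ x ⁆))) (cong ∣_∣ p-x+x≡p))
  where
  p-x+x≡p : (p - x) +ˢ x ≡ p
  p-x+x≡p = ⊆-antisym (+ˢ-least (p─q⊆p p ⁅ x ⁆) x∈p) p⊆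
    where
    p⊆ : p ⊆ (p - x) +ˢ x
    p⊆ {y} y∈p with y ≟ x
    ... | yes refl = x∈A+x (p - x) x
    ... | no  y≢x  = y∈A⇒y∈A+x (x∈p∧x≢y⇒x∈p-y y∈p y≢x)

-- Shelling intervals of faces by vertex decomposition.

++-split : ∀ {A : Set} (xs ys : List A) {pre z post} → xs ++ ys ≡ pre ++ z ∷ post →
  (∃[ m ] xs ≡ pre ++ z ∷ m) ⊎ (∃[ m ] pre ≡ xs ++ m × ys ≡ m ++ z ∷ post)
++-split []       ys {pre}     eq   = inj₂ (pre , refl , eq)
++-split (x ∷ xs) ys {[]}      refl = inj₁ (xs , refl)
++-split (x ∷ xs) ys {_ ∷ pre} eq with ∷-injective eq
... | refl , eq′ = Sum.map (λ { (m , e) → m , cong (x ∷_) e })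
                           (λ { (m , e , e′) → m , cong (x ∷_) e , e′ }) (++-split xs ys {pre} eq′)

module Shelling {n} (Δ : Subset n → Set) (Δ? : Decidable Δ)
                (Δ-down : ∀ {A B} → A ⊆ B → Δ B → Δ A) where

  -- Exchange form of a shedding vertex: since `x` differs from `w`, the set `A - w` is never
  -- maximal among the faces between `F` and `E` that avoid `w`.
  Shedding : Subset n → Subset n → Fin n → Set
  Shedding F E w = ∀ A → Δ A → F ⊆ A → A ⊆ E → w ∈ A →
    ∃[ x ] x ∈ E × x ∉ A × Δ ((A - w) +ˢ x)

  -- These are the facets of the link of `F` in the restriction of `Δ` to `E`, with `F` put back.
  -- Testing single vertices suffices because `Δ` is closed under subsets.
  record Maximal (F E A : Subset n) : Set where
    constructor maximal
    field
      face  : Δ A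
      lower : F ⊆ A
      upper : A ⊆ E
      max   : ∀ x → x ∈ E → x ∉ A → ¬ Δ (A +ˢ x)
  open Maximal

  -- The usual exchange criterion for nonpure shellings: the intersection of `A` with any earlier
  -- `B` lies in some `A - x`, which is contained in an earlier `C`.
  Shelled : List (Subset n) → Set
  Shelled Fs = ∀ pre A post → Fs ≡ pre ++ A ∷ post → ∀ B → B List.∈ pre →
    ∃[ C ] C List.∈ pre × (∃[ x ] x ∈ A × x ∉ B × A - x ⊆ C)

  record IntervalShelling (F E : Subset n) : Set where
    field
      facets  : List (Subset n)
      unique  : Unique facets
      sound   : ∀ {A} → A List.∈ facets → Maximal F E A
      complete : ∀ {A} → Maximal F E A → A List.∈ facets
      shelled : Shelled facets
  open IntervalShelling

  -- Greedy extension: vertices of `E` are added while the result is a face, and `k` bounds how many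
  -- can still be added.
  extend : ∀ k {F E A} → ∣ E ∣ ≤ ∣ A ∣ + k → Δ A → F ⊆ A → A ⊆ E →
    ∃[ C ] Maximal F E C × A ⊆ C
  extend k {F} {E} {A} bound ΔA F⊆A A⊆E
    with any? (λ x → x ∈? E ×-dec ¬? (x ∈? A) ×-dec Δ? (A +ˢ x))
  ... | no none = A , maximal ΔA F⊆A A⊆E (λ x x∈E x∉A ΔAx → none (x , x∈E , x∉A , ΔAx)) , λ z → z
  extend zero {A = A} bound ΔA F⊆A A⊆E | yes (x , x∈E , x∉A , ΔAx) =
    contradiction bound (ℕ.<⇒≱ (subst (_< _) (≡-sym (ℕ.+-identityʳ ∣ A ∣)) (p⊂q⇒∣p∣<∣q∣ (A⊆E , x , x∈E , x∉A))))
  extend (suc k) {A = A} bound ΔA F⊆A A⊆E | yes (x , x∈E , x∉A , ΔAx)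
    with extend k (ℕ.≤-trans bound (ℕ.≤-trans (ℕ.≤-reflexive (ℕ.+-suc ∣ A ∣ k)) (ℕ.+-monoˡ-≤ k (∣A∣<∣A+x∣ x∉A))))
                ΔAx (λ z → y∈A⇒y∈A+x (F⊆A z)) (+ˢ-least A⊆E x∈E)
  ... | C , maxC , A+x⊆C = C , maxC , λ z → A+x⊆C (y∈A⇒y∈A+x z)

  simplex : ∀ {F E} → F ⊆ E → Δ E → IntervalShelling F E
  simplex {F} {E} F⊆E ΔE = record
    { facets   = E ∷ []
    ; unique   = [] ∷ []
    ; sound    = λ { (here refl) → maximal ΔE F⊆E (λ z → z) (λ x x∈E x∉E → contradiction x∈E x∉E) }
    ; complete = λ {A} M → here (⊆-antisym (upper M) λ {x} x∈E →
        decidable-stable (x ∈? A) λ x∉A →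
          max M x x∈E x∉A (Δ-down (+ˢ-least (upper M) x∈E) ΔE))
    ; shelled  = λ { [] A post eq B () ; (_ ∷ []) A post () B B∈ ; (_ ∷ _ ∷ _) A post () B B∈ }
    }

  empty : ∀ {F E} → ¬ Δ F → IntervalShelling F E
  empty ¬ΔF = record
    { facets   = []
    ; unique   = []
    ; sound    = λ ()
    ; complete = λ M → contradiction (Δ-down (lower M) (face M)) ¬ΔF
    ; shelled  = λ { [] A post () B B∈ ; (_ ∷ _) A post () B B∈ }
    }

  -- The facets avoiding a shedding vertex w come first; a facet A containing w
  -- then meets each of them inside A - w, which lies in one of them.
  shed : ∀ {F E w} → w ∈ E → w ∉ F → Shedding F E w →
    IntervalShelling F (E - w) → IntervalShelling (F +ˢ w) E → IntervalShelling F E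
  shed {F} {E} {w} w∈E w∉F shedding S₁ S₂ = record
    { facets   = facets S₁ ++ facets S₂
    ; unique   = Unique.++⁺ (unique S₁) (unique S₂)
                   λ { (∈₁ , ∈₂) → avoids (sound S₁ ∈₁) (contains (sound S₂ ∈₂)) }
    ; sound    = λ A∈ → Sum.[ raise₁ ∘ sound S₁ , raise₂ ∘ sound S₂ ] (∈-++⁻ (facets S₁) A∈)
    ; complete = split
    ; shelled  = order
    }
    where
    avoids : ∀ {A} → Maximal F (E - w) A → w ∉ A
    avoids M w∈A = proj₂ (x∈p-y⁻ E w (upper M w∈A)) refl

    contains : ∀ {A} → Maximal (F +ˢ w) E A → w ∈ A
    contains M = lower M (x∈A+x F w)

    below : ∀ {A} → Maximal F (E - w) A → A ⊆ E
    below M z = proj₁ (x∈p-y⁻ E w (upper M z))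

    raise₁ : ∀ {A} → Maximal F (E - w) A → Maximal F E A
    raise₁ {A} M = maximal (face M) (lower M) (below M) max′
      where
      max′ : ∀ x → x ∈ E → x ∉ A → ¬ Δ (A +ˢ x)
      max′ x x∈E x∉A ΔA+x with x ≟ w
      ... | no x≢w = max M x (x∈p∧x≢y⇒x∈p-y x∈E x≢w) x∉A ΔA+x
      -- If `A +ˢ w` were a face, trading `w` for some `y` would make `A +ˢ y` a face inside
      -- `E - w`, against the maximality of `A` there.
      ... | yes refl with shedding (A +ˢ w) ΔA+x (λ z → y∈A⇒y∈A+x (lower M z))
                                   (+ˢ-least (below M) x∈E) (x∈A+x A w)
      ... | y , y∈E , y∉ , Δ′ =
        max M y (x∈p∧x≢y⇒x∈p-y y∈E λ { refl → y∉ (x∈A+x A w) }) (λ y∈A → y∉ (y∈A⇒y∈A+x y∈A))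
          (Δ-down (+ˢ-least (λ z → y∈A⇒y∈A+x (x∈p∧x≢y⇒x∈p-y (y∈A⇒y∈A+x z) λ { refl → x∉A z }))
                            (x∈A+x (A +ˢ w - w) y)) Δ′)

    raise₂ : ∀ {A} → Maximal (F +ˢ w) E A → Maximal F E A
    raise₂ M = maximal (face M) (λ z → lower M (y∈A⇒y∈A+x z)) (upper M) (max M)

    split : ∀ {A} → Maximal F E A → A List.∈ facets S₁ ++ facets S₂
    split {A} M with w ∈? A
    ... | yes w∈A = ∈-++⁺ʳ (facets S₁) (complete S₂
          (maximal (face M) (+ˢ-least (lower M) w∈A) (upper M) (max M)))
    ... | no  w∉A = ∈-++⁺ˡ (complete S₁ (maximal (face M) (lower M)
          (λ z → x∈p∧x≢y⇒x∈p-y (upper M z) λ { refl → w∉A z })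
          (λ x x∈ → max M x (proj₁ (x∈p-y⁻ E w x∈)))))

    order : Shelled (facets S₁ ++ facets S₂)
    order pre A post eq B B∈pre with ++-split (facets S₁) (facets S₂) eq
    ... | inj₁ (m , eq₁) = shelled S₁ pre A m eq₁ B B∈pre
    ... | inj₂ (m , refl , eq₂) with ∈-++⁻ (facets S₁) B∈pre
    ...   | inj₂ B∈m with shelled S₂ m A post eq₂ B B∈m
    ...     | C , C∈m , rest = C , ∈-++⁺ʳ (facets S₁) C∈m , rest
    order pre A post eq B B∈pre | inj₂ (m , refl , eq₂) | inj₁ B∈₁
      with sound S₂ (subst (A List.∈_) (≡-sym eq₂) (∈-++⁺ʳ m (here refl)))
    ... | MA with extend ∣ E - w ∣ {F} {E - w} {A - w} (ℕ.m≤n+m _ _)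
                    (Δ-down (p─q⊆p A ⁅ w ⁆) (face MA))
                    (λ z → x∈p∧x≢y⇒x∈p-y (lower MA (y∈A⇒y∈A+x z)) λ { refl → w∉F z })
                    (λ z → let z∈A , z≢w = x∈p-y⁻ A w z in x∈p∧x≢y⇒x∈p-y (upper MA z∈A) z≢w)
    ... | C , MC , A-w⊆C =
      C , ∈-++⁺ˡ (complete S₁ MC) , w , contains MA , avoids (sound S₁ B∈₁) , A-w⊆C

  HasShedding : Set
  HasShedding = ∀ {F E} → F ⊆ E → Δ F → ¬ Δ E → ∃[ w ] w ∈ E × w ∉ F × Shedding F E w

  -- The recursion is on a bound `k` for the number of vertices of `E` outside `F`; deleting `w`
  -- from `E` and adding it to `F` both lower this number.
  intervalShelling : HasShedding → ∀ k {F E} → F ⊆ E → ∣ E ∣ ≤ ∣ F ∣ + k → IntervalShelling F E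
  intervalShelling hs k {F} {E} F⊆E bound with Δ? F
  ... | no ¬ΔF = empty ¬ΔF
  ... | yes ΔF with Δ? E
  ... | yes ΔE = simplex F⊆E ΔE
  ... | no ¬ΔE with hs F⊆E ΔF ¬ΔE
  intervalShelling hs zero {F} {E} F⊆E bound | yes ΔF | no ¬ΔE | w , w∈E , w∉F , sh =
    contradiction bound (ℕ.<⇒≱ (subst (_< _) (≡-sym (ℕ.+-identityʳ ∣ F ∣)) (p⊂q⇒∣p∣<∣q∣ (F⊆E , w , w∈E , w∉F))))
  intervalShelling hs (suc k) {F} {E} F⊆E bound | yes ΔF | no ¬ΔE | w , w∈E , w∉F , sh =
    shed w∈E w∉F sh
      (intervalShelling hs k (λ z → x∈p∧x≢y⇒x∈p-y (F⊆E z) λ { refl → w∉F z })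
        (ℕ.≤-pred (ℕ.≤-trans (x∈p⇒∣p-x∣<∣p∣ w∈E) bound′)))
      (intervalShelling hs k (+ˢ-least F⊆E w∈E)
        (ℕ.≤-trans bound′ (ℕ.+-monoˡ-≤ k (∣A∣<∣A+x∣ w∉F))))
    where
    bound′ : ∣ E ∣ ≤ suc (∣ F ∣ + k)
    bound′ = ℕ.≤-trans bound (ℕ.≤-reflexive (ℕ.+-suc ∣ F ∣ k))

  shellable : HasShedding → Shellable Δ
  shellable hs = facets S , unique S , (λ F → mk⇔ (complete S ∘ isMax) (isFacet ∘ sound S)) , pure
    where
    S : IntervalShelling ⊥ ⊤
    S = intervalShelling hs ∣ ⊤ {n} ∣ (⊆-min ⊤) (ℕ.m≤n+m _ _)

    isMax : ∀ {A} → IsFacet Δ A → Maximal ⊥ ⊤ A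
    isMax {A} (ΔA , max) = maximal ΔA (⊆-min A) (⊆-max A)
      λ x _ x∉A ΔA+x → x∉A (max _ ΔA+x y∈A⇒y∈A+x (x∈A+x A x))

    isFacet : ∀ {A} → Maximal ⊥ ⊤ A → IsFacet Δ A
    isFacet {A} M = face M , λ B ΔB A⊆B {x} x∈B → decidable-stable (x ∈? A) λ x∉A →
      max M x ∈⊤ x∉A (Δ-down (+ˢ-least A⊆B x∈B) ΔB)

    -- A facet `σ` of the intersection lies in `F` and in an earlier `B`, hence in `F - x`. As
    -- `F - x` itself belongs to the intersection, maximality gives equality.
    pure : ∀ pre F post → facets S ≡ pre ++ F ∷ post → pre ≢ [] →
      ∀ σ → IsFacet (Generated (F ∷ []) ∩ᶜ Generated pre) σ → ∣ σ ∣ + 1 ≡ ∣ F ∣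
    pure pre F post eq _ σ ((here σ⊆F , σ∈pre) , σmax) with find σ∈pre
    ... | B , B∈pre , σ⊆B with shelled S pre F post eq B B∈pre
    ... | C , C∈pre , x , x∈F , x∉B , F-x⊆C =
      trans (cong (λ τ → ∣ τ ∣ + 1) σ≡F-x) (∣p-x∣+1≡∣p∣ x∈F)
      where
      σ⊆F-x : σ ⊆ F - x
      σ⊆F-x z = x∈p∧x≢y⇒x∈p-y (σ⊆F z) λ { refl → x∉B (σ⊆B z) }
      σ≡F-x : σ ≡ F - x
      σ≡F-x = ⊆-antisym σ⊆F-x
        (σmax (F - x) (here (p─q⊆p F ⁅ x ⁆) , lose C∈pre F-x⊆C) σ⊆F-x)

-- Counting by lists, decidable subsets and maximizers.

length≤∣p∣ : ∀ {p : Subset n} {xs} → Unique xs → All (_∈ p) xs → length xs ≤ ∣ p ∣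
length≤∣p∣ []            []           = z≤n
length≤∣p∣ {p = p} {x ∷ xs} (x∉xs ∷ uxs) (x∈p ∷ xs∈p) = begin
  suc (length xs)  ≡⟨ ℕ.+-comm 1 (length xs) ⟩
  length xs + 1    ≤⟨ ℕ.+-monoˡ-≤ 1 (length≤∣p∣ uxs xs∈p-x) ⟩
  ∣ p - x ∣ + 1    ≡⟨ ∣p-x∣+1≡∣p∣ x∈p ⟩
  ∣ p ∣            ∎
  where
  open ℕ.≤-Reasoning
  xs∈p-x : All (_∈ p - x) xs
  xs∈p-x = All.zipWith (λ { (y∈p , x≢y) → x∈p∧x≢y⇒x∈p-y y∈p (x≢y ∘ ≡-sym) }) (xs∈p , x∉xs)

-- Together with `length≤∣p∣`, this translates between cardinalities and the duplicate-free lists by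
-- which `RIndependent` measures components.
enumerate : ∀ (p : Subset n) → ∃[ xs ] Unique xs × All (_∈ p) xs × length xs ≡ ∣ p ∣
enumerate []      = [] , [] , [] , refl
enumerate (b ∷ p) with enumerate p
enumerate (false ∷ p) | xs , uxs , xs∈p , eq =
  map suc xs , Unique.map⁺ suc-injective uxs , All.map⁺ (All.map Vec.there xs∈p) ,
  trans (length-map suc xs) eq
enumerate (true ∷ p) | xs , uxs , xs∈p , eq =
  zero ∷ map suc xs , All.map⁺ (All.tabulate (λ _ ())) ∷ Unique.map⁺ suc-injective uxs ,
  Vec.here ∷ All.map⁺ (All.map Vec.there xs∈p) , cong suc (trans (length-map suc xs) eq)

module _ {P : Fin n → Set} (P? : Decidable P) where

  ⟦_⟧ : Subset n
  ⟦_⟧ = tabulate (does ∘ P?)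

  ∈⟦⟧⁺ : ∀ {x} → P x → x ∈ ⟦_⟧
  ∈⟦⟧⁺ {x} Px = lookup⇒[]= x _ (trans (lookup∘tabulate _ x) (dec-true (P? x) Px))

  ∈⟦⟧⁻ : ∀ {x} → x ∈ ⟦_⟧ → P x
  ∈⟦⟧⁻ {x} x∈ with P? x | trans (≡-sym (lookup∘tabulate (does ∘ P?) x)) ([]=⇒lookup x∈)
  ... | yes Px | _ = Px

  maximizer : (f : Fin n → ℕ) → ∃ P → ∃[ m ] P m × (∀ x → P x → f x ≤ f m)
  maximizer f (x₀ , Px₀) =
    argmax f x₀ candidates ,
    argmax-all f Px₀ (All.all-filter P? (allFin n)) ,
    λ x Px → All.lookup (f[xs]≤f[argmax] {f = f} x₀ candidates) (∈-filter⁺ P? (∈-allFin x) Px)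
    where
    candidates : List (Fin n)
    candidates = filter P? (allFin n)

-- Rooted forests and their branches.

module _ {G : Graph n} {P : Fin n → Set} where

  snoc : ∀ {u v w k} → WalkIn G P u v k → Adj G v w → P w → WalkIn G P u w (suc k)
  snoc (nil Pu)       vw Pw = cons Pu vw (nil Pw)
  snoc (cons Pu uz z) vw Pw = cons Pu uz (snoc z vw Pw)

Adj-sym : ∀ (G : Graph n) {u v} → Adj G u v → Adj G v u
Adj-sym G {u} {v} = subst T (sym G u v)

-- A rooted forest encoded by depths: the parent relation is derived from them, and roots are the
-- vertices without a parent.
record Rooting (G : Graph n) : Set where
  field
    depth : Fin n → ℕ

  Parent : Fin n → Fin n → Set
  Parent z p = Adj G z p × depth z ≡ suc (depth p)

  field
    edge          : ∀ {u v} → Adj G u v → Parent u v ⊎ Parent v u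
    parent-unique : ∀ {z p q} → Parent z p → Parent z q → p ≡ q

module Forest {n} {G : Graph n} (R : Rooting G) where
  open Rooting R

  data Up (A : Subset n) : Fin n → Fin n → Set where
    here : ∀ {z} → z ∈ A → Up A z z
    up   : ∀ {z p y} → z ∈ A → Parent z p → Up A p y → Up A z y

  private variable
    A B : Subset n
    u x y z : Fin n

  source∈ : Up A z y → z ∈ A
  source∈ (here z∈A)   = z∈A
  source∈ (up z∈A _ _) = z∈A

  target∈ : Up A z y → y ∈ A
  target∈ (here z∈A)   = z∈A
  target∈ (up _ _ p↑y) = target∈ p↑y

  up-mono : A ⊆ B → Up A z y → Up B z y
  up-mono A⊆B (here z∈A)        = here (A⊆B z∈A)
  up-mono A⊆B (up z∈A par p↑y) = up (A⊆B z∈A) par (up-mono A⊆B p↑y)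

  up-trans : Up A z y → Up A y x → Up A z x
  up-trans (here _)          y↑x = y↑x
  up-trans (up z∈A par p↑y) y↑x = up z∈A par (up-trans p↑y y↑x)

  up-depth : Up A z y → depth y ≤ depth z
  up-depth (here _)             = ℕ.≤-refl
  up-depth (up _ (_ , eq) p↑y) =
    ℕ.≤-trans (ℕ.m≤n⇒m≤1+n (up-depth p↑y)) (ℕ.≤-reflexive (≡-sym eq))

  up-strict : Up A z y → depth z ≤ depth y → z ≡ y
  up-strict (here _)             _   = refl
  up-strict (up _ (_ , eq) p↑y) d≤d = contradiction (ℕ.≤-trans (ℕ.≤-reflexive (≡-sym eq)) d≤d)
    (ℕ.≤⇒≯ (up-depth p↑y))

  -- Unique parents force both ascending paths from `x` along the same chain, so the deeper endpoint
  -- `y` lies on the path to `u` and cuts it into two pieces inside `A`.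
  up-linear : Up A x u → Up B x y → depth u ≤ depth y → Up A x y × Up A y u
  up-linear (here x∈A) x↑y d≤d with up-strict x↑y d≤d
  ... | refl = here x∈A , here x∈A
  up-linear x↑u@(up x∈A _ _) (here _) _ = here x∈A , x↑u
  up-linear (up x∈A par p↑u) (up _ par′ q↑y) d≤d with parent-unique par par′
  ... | refl with up-linear p↑u q↑y d≤d
  ... | p↑y , y↑u = up x∈A par p↑y , y↑u

  up-or-gap : ∀ A → Up B z y → Up A z y ⊎ (∃[ x ] x ∉ A × Up B z x × Up B x y)
  up-or-gap {z = z} A z↑y with z ∈? A
  up-or-gap A z↑y               | no  z∉A = inj₂ (_ , z∉A , here (source∈ z↑y) , z↑y)
  up-or-gap A (here _)          | yes z∈A = inj₁ (here z∈A)
  up-or-gap A (up z∈B par p↑y) | yes z∈A with up-or-gap A p↑y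
  ... | inj₁ p↑y′                  = inj₁ (up z∈A par p↑y′)
  ... | inj₂ (x , x∉A , p↑x , x↑y) = inj₂ (x , x∉A , up z∈B par p↑x , x↑y)

  -- Uniqueness of the parent leaves a single candidate for the next step, and the depth decreases
  -- along it.
  up? : ∀ A z y → Dec (Up A z y)
  up? A z y = go (depth z) z refl
    where
    go : ∀ k z → depth z ≡ k → Dec (Up A z y)
    go k z eq with z ∈? A
    ... | no z∉A = no (z∉A ∘ source∈)
    ... | yes z∈A with z ≟ y
    ... | yes refl = yes (here z∈A)
    ... | no z≢y with any? (λ p → T? (adj G z p) ×-dec depth z ℕ.≟ suc (depth p))
    ... | no orphan = no λ { (here _) → z≢y refl ; (up _ par _) → orphan (_ , par) }
    go zero    z eq | yes z∈A | no z≢y | yes (p , par) with trans (≡-sym eq) (proj₂ par)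
    ... | ()
    go (suc k) z eq | yes z∈A | no z≢y | yes (p , par)
      with go k p (ℕ.suc-injective (trans (≡-sym (proj₂ par)) eq))
    ... | yes p↑y = yes (up z∈A par p↑y)
    ... | no ¬p↑y = no λ { (here _) → z≢y refl
                         ; (up _ par′ q↑y) → ¬p↑y (subst (λ q → Up A q y) (parent-unique par′ par) q↑y) }

  -- The component of G[A] containing y, restricted to the descendants of y.
  branch : Subset n → Fin n → Subset n
  branch A y = ⟦ (λ z → up? A z y) ⟧

  ∈branch⁺ : Up A z y → z ∈ branch A y
  ∈branch⁺ {A} {y = y} = ∈⟦⟧⁺ (λ z → up? A z y)

  ∈branch⁻ : z ∈ branch A y → Up A z y
  ∈branch⁻ {A = A} {y = y} = ∈⟦⟧⁻ (λ z → up? A z y)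

  branch-mono : A ⊆ B → branch A y ⊆ branch B y
  branch-mono A⊆B = ∈branch⁺ ∘ up-mono A⊆B ∘ ∈branch⁻

  branch-up : Up A x y → branch A x ⊆ branch A y
  branch-up x↑y z∈ = ∈branch⁺ (up-trans (∈branch⁻ z∈) x↑y)

  ∣branch∣-strict : Up A x y → x ≢ y → ∣ branch A x ∣ < ∣ branch A y ∣
  ∣branch∣-strict x↑y x≢y = p⊂q⇒∣p∣<∣q∣
    ( branch-up x↑y , _ , ∈branch⁺ (here (target∈ x↑y))
    , λ y∈ → x≢y (up-strict x↑y (up-depth (∈branch⁻ y∈))) )

  branch-gap : ∀ A → ∣ branch A y ∣ < ∣ branch B y ∣ → ∃[ x ] x ∉ A × Up B x y
  branch-gap {y = y} {B = B} A ∣A∣<∣B∣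
    with any? (λ x → ¬? (x ∈? A) ×-dec up? B x y)
  ... | yes gap  = gap
  ... | no ¬gap = contradiction (p⊆q⇒∣p∣≤∣q∣ B⊆A) (ℕ.<⇒≱ ∣A∣<∣B∣)
    where
    B⊆A : branch B y ⊆ branch A y
    B⊆A z∈ with up-or-gap A (∈branch⁻ z∈)
    ... | inj₁ z↑y                 = ∈branch⁺ z↑y
    ... | inj₂ (x , x∉A , _ , x↑y) = contradiction (x , x∉A , x↑y) ¬gap

  -- `t` is the highest point of the walk so far. A new first edge going down from `v` to `z` either
  -- makes `v` the new top or undoes the first step of the ascent from `z`, because parents are
  -- unique.
  walk⇒up : ∀ {v w k} → WalkIn G (_∈ A) v w k → ∃[ t ] Up A v t × Up A w t
  walk⇒up (nil v∈A) = _ , here v∈A , here v∈A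
  walk⇒up (cons v∈A vz walk) with walk⇒up walk | edge vz
  ... | t , z↑t , w↑t | inj₁ par = t , up v∈A par z↑t , w↑t
  ... | t , here z∈A , w↑t | inj₂ par = _ , here v∈A , up-trans w↑t (up z∈A par (here v∈A))
  ... | t , up z∈A par′ p↑t , w↑t | inj₂ par with parent-unique par par′
  ...   | refl = t , p↑t , w↑t

  up⇒walk : Up A z y → SameComponent G A y z
  up⇒walk (here z∈A) = 0 , nil z∈A
  up⇒walk (up z∈A (zp , _) p↑y) with up⇒walk p↑y
  ... | k , walk = suc k , snoc walk (Adj-sym G zp) z∈A

  -- Independence through branch sizes, and exchanges of vertices.

  module _ (r : ℕ) where

    Small : Subset n → Set
    Small A = ∀ y → ∣ branch A y ∣ ≤ r

    -- The component of `v` is the branch of its topmost vertex, which is found as the vertex `t`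
    -- above `v` with the largest branch.
    small⇒independent : Small A → RIndependent r G A
    small⇒independent {A} small v v∈A ws unique connected
      with maximizer (up? A v) (∣_∣ ∘ branch A) (v , here v∈A)
    ... | t , v↑t , max = ℕ.≤-trans (length≤∣p∣ unique (All.map inBranch connected)) (small t)
      where
      inBranch : ∀ {w} → SameComponent G A v w → w ∈ branch A t
      inBranch (_ , walk) with walk⇒up walk
      ... | s , v↑s , w↑s with ℕ.≤-total (depth t) (depth s)
      ... | inj₁ dt≤ds = ∈branch⁺ (up-trans w↑s (proj₂ (up-linear v↑t v↑s dt≤ds)))
      -- A meeting point `s` properly above `t` would have a strictly larger branch.
      ... | inj₂ ds≤dt with t ≟ s
      ... | yes refl = ∈branch⁺ w↑s
      ... | no t≢s   = contradiction (max s v↑s)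
            (ℕ.<⇒≱ (∣branch∣-strict (proj₂ (up-linear v↑s v↑t ds≤dt)) t≢s))

    independent⇒small : RIndependent r G A → Small A
    independent⇒small {A} independent y with y ∈? A
    ... | no y∉A = ℕ.≤-trans (ℕ.≤-reflexive (trans (cong ∣_∣ (Empty-unique
            λ { (_ , z∈) → y∉A (target∈ (∈branch⁻ z∈)) })) (∣⊥∣≡0 n))) z≤n
    ... | yes y∈A with enumerate (branch A y)
    ... | ws , unique , ws∈ , eq = subst (_≤ r) eq
            (independent y y∈A ws unique (All.map (up⇒walk ∘ ∈branch⁻) ws∈))

    small? : Decidable Small
    small? A = all? λ y → ∣ branch A y ∣ ≤? r

    independent? : Decidable (RIndependent r G)
    independent? A = map′ small⇒independent independent⇒small (small? A)

    independent-down : A ⊆ B → RIndependent r G B → RIndependent r G A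
    independent-down A⊆B indB = small⇒independent λ y →
      ℕ.≤-trans (p⊆q⇒∣p∣≤∣q∣ (branch-mono A⊆B)) (independent⇒small indB y)

    DeepSmall : Subset n → ℕ → Set
    DeepSmall E d = ∀ u → d < depth u → ∣ branch E u ∣ ≤ r

    -- Whether A - w + x is small is only in doubt at ancestors of x that are not deep.
    exchange : ∀ {A E w x d} → Small A → A ⊆ E → x ∈ E → DeepSmall E d →
      (∀ u → depth u ≤ d → Up ((A - w) +ˢ x) x u → ∣ branch ((A - w) +ˢ x) u ∣ ≤ r) →
      Small ((A - w) +ˢ x)
    exchange {A} {E} {w} {x} {d} small A⊆E x∈E deep shallow u with up? ((A - w) +ˢ x) x u
    ... | yes x↑u with depth u ≤? d
    ...   | yes du≤d = shallow u du≤d x↑u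
    ...   | no  du≰d = ℕ.≤-trans (p⊆q⇒∣p∣≤∣q∣ (branch-mono A′⊆E)) (deep u (ℕ.≰⇒> du≰d))
      where
      A′⊆E : (A - w) +ˢ x ⊆ E
      A′⊆E = +ˢ-least (λ z → A⊆E (p─q⊆p A ⁅ w ⁆ z)) x∈E
    exchange {A} {E} {w} {x} small A⊆E x∈E deep shallow u | no ¬x↑u =
      ℕ.≤-trans (p⊆q⇒∣p∣≤∣q∣ inA) (small u)
      where
      inA : branch ((A - w) +ˢ x) u ⊆ branch A u
      inA z∈ with up-or-gap A (∈branch⁻ z∈)
      ... | inj₁ z↑u = ∈branch⁺ z↑u
      ... | inj₂ (y , y∉A , _ , y↑u) with y∈A+x⁻ (A - w) x (source∈ y↑u)
      ...   | inj₁ y∈  = contradiction (p─q⊆p A ⁅ w ⁆ y∈) y∉A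
      ...   | inj₂ refl = contradiction y↑u ¬x↑u

    removed : ∀ (A : Subset n) {w x} → x ≢ w → w ∉ (A - w) +ˢ x
    removed A {w} {x} x≢w w∈ with y∈A+x⁻ (A - w) x w∈
    ... | inj₁ w∈A-w = proj₂ (x∈p-y⁻ A w w∈A-w) refl
    ... | inj₂ w≡x   = x≢w (≡-sym w≡x)

    -- An ascending path from `x` to depth at most that of `w` passes through `w`, which has just
    -- been removed; so there is no shallow ancestor to check.
    exchange-below : ∀ {A E w x} → Small A → A ⊆ E → DeepSmall E (depth w) →
      w ∈ A → x ∉ A → Up E x w → Small ((A - w) +ˢ x)
    exchange-below {A} {w = w} {x} small A⊆E deep w∈A x∉A x↑w =
      exchange small A⊆E (source∈ x↑w) deep λ u du≤dw x↑u →
        contradiction (source∈ (proj₂ (up-linear x↑u x↑w du≤dw)))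
                      (removed A λ { refl → x∉A w∈A })

    -- At an ancestor u of y the branch of w is lost and at most that of x is
    -- gained, and the latter is no bigger.
    exchange-across : ∀ {A E w x y} → Small A → A ⊆ E → DeepSmall E (depth y) →
      y ∈ A → w ∈ A → x ∉ A → w ≢ y → Up A w y → Up E x y →
      branch E w ⊆ branch A w → ∣ branch E x ∣ ≤ ∣ branch E w ∣ → Small ((A - w) +ˢ x)
    exchange-across {A} {E} {w} {x} {y} small A⊆E deep y∈A w∈A x∉A w≢y w↑y x↑y full lighter =
      exchange small A⊆E (source∈ x↑y) deep shallow
      where
      A′ = (A - w) +ˢ x

      x≢w : x ≢ w
      x≢w refl = x∉A w∈A

      w∉A′ : w ∉ A′
      w∉A′ = removed A x≢w

      shallow : ∀ u → depth u ≤ depth y → Up A′ x u → ∣ branch A′ u ∣ ≤ r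
      -- The size of `branch E w` is added on both sides and cancelled at the end, which avoids
      -- subtraction.
      shallow u du≤dy x↑u = ℕ.≤-trans (ℕ.+-cancelʳ-≤ ∣ branch E w ∣ _ _ (begin
          ∣ branch A′ u ∣ + ∣ branch E w ∣  ≡⟨ disjoint⇒∣p∪q∣≡∣p∣+∣q∣ (branch A′ u) (branch E w) disjoint ⟨
          ∣ branch A′ u ∪ branch E w ∣      ≤⟨ p⊆q⇒∣p∣≤∣q∣ covered ⟩
          ∣ branch A u ∪ branch E x ∣       ≤⟨ ∣p∪q∣≤∣p∣+∣q∣ (branch A u) (branch E x) ⟩
          ∣ branch A u ∣ + ∣ branch E x ∣   ≤⟨ ℕ.+-monoʳ-≤ ∣ branch A u ∣ lighter ⟩
          ∣ branch A u ∣ + ∣ branch E w ∣   ∎)) (small u)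
        where
        open ℕ.≤-Reasoning

        -- Only `x` can lie in `A′` but not in `A`, so an ascending path in `A′` that leaves `A`
        -- passes through `x`.
        through-x : ∀ {z v} → Up A′ z v → Up A z v ⊎ (Up A′ z x × Up A′ x v)
        through-x z↑v with up-or-gap A z↑v
        ... | inj₁ z↑v′ = inj₁ z↑v′
        ... | inj₂ (q , q∉A , z↑q , q↑v) with y∈A+x⁻ (A - w) x (source∈ q↑v)
        ...   | inj₁ q∈A  = contradiction (p─q⊆p A ⁅ w ⁆ q∈A) q∉A
        ...   | inj₂ refl = inj₂ (z↑q , q↑v)

        -- `y` lies on the path from `x` to `u`. Its upper piece cannot return to `x`: that would
        -- give `x` equal to `y`, but `y` is in `A`.
        y↑u : Up A y u
        y↑u with through-x (proj₂ (up-linear x↑u x↑y du≤dy))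
        ... | inj₁ y↑u′      = y↑u′
        ... | inj₂ (y↑x , _) with up-strict x↑y (up-depth y↑x)
        ...   | refl = contradiction y∈A x∉A

        dy<dw : depth y < depth w
        dy<dw = ℕ.≰⇒> λ dw≤dy → w≢y (up-strict w↑y dw≤dy)

        -- A common vertex would ascend to `u` inside `A′` through the deeper vertex `w`, which is
        -- not in `A′`.
        disjoint : ∀ {z} → z ∈ branch A′ u → z ∉ branch E w
        disjoint z∈ z∈′ = w∉A′ (source∈ (proj₂ (up-linear (∈branch⁻ z∈) (∈branch⁻ z∈′)
          (ℕ.≤-trans du≤dy (ℕ.<⇒≤ dy<dw)))))

        A′⊆E : A′ ⊆ E
        A′⊆E = +ˢ-least (λ z → A⊆E (p─q⊆p A ⁅ w ⁆ z)) (source∈ x↑y)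

        covered : branch A′ u ∪ branch E w ⊆ branch A u ∪ branch E x
        covered z∈ with x∈p∪q⁻ (branch A′ u) (branch E w) z∈
        ... | inj₂ z∈w = x∈p∪q⁺ (inj₁ (branch-up (up-trans w↑y y↑u) (full z∈w)))
        ... | inj₁ z∈u with through-x (∈branch⁻ z∈u)
        ...   | inj₁ z↑u       = x∈p∪q⁺ (inj₁ (∈branch⁺ z↑u))
        ...   | inj₂ (z↑x , _) = x∈p∪q⁺ (inj₂ (∈branch⁺ (up-mono A′⊆E z↑x)))

    -- Existence of shedding vertices.

    open Shelling (RIndependent r G) independent? independent-down

    hasShedding : HasShedding
    hasShedding {F} {E} F⊆E indF ¬indE
      with maximizer (λ y → suc r ≤? ∣ branch E y ∣) depth big
      where
      big : ∃[ y ] r < ∣ branch E y ∣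
      big with ¬∀⟶∃¬ n _ (λ y → ∣ branch E y ∣ ≤? r) (¬indE ∘ small⇒independent)
      ... | y , ≰r = y , ℕ.≰⇒> ≰r
    ... | y , y-big , y-max = choose (y ∈? F)
      where
      deep : DeepSmall E (depth y)
      deep u dy<du = ℕ.≮⇒≥ λ u-big → ℕ.<⇒≱ dy<du (y-max u u-big)

      gap : ∀ {A} → Small A → ∃[ x ] x ∉ A × Up E x y
      gap {A} small = branch-gap A (ℕ.≤-<-trans (small y) y-big)

      y∈E : y ∈ E
      y∈E = target∈ (proj₂ (proj₂ (gap (independent⇒small indF))))

      choose : Dec (y ∈ F) → ∃[ w ] w ∈ E × w ∉ F × Shedding F E w
      choose (no y∉F) = y , y∈E , y∉F , shed-y
        where
        shed-y : Shedding F E y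
        shed-y A indA F⊆A A⊆E y∈A with gap (independent⇒small indA)
        ... | x , x∉A , x↑y = x , source∈ x↑y , x∉A ,
          small⇒independent (exchange-below (independent⇒small indA) A⊆E deep y∈A x∉A x↑y)
      choose (yes y∈F)
        -- A candidate exists because `F` is independent while the branch of `y` in `E` is too big.
        with maximizer (λ w → ¬? (w ∈? F) ×-dec up? E w y) (∣_∣ ∘ branch E)
                       (gap (independent⇒small indF))
      ... | w , (w∉F , w↑y) , heaviest = w , source∈ w↑y , w∉F , shed-w
        where
        w≢y : w ≢ y
        w≢y refl = w∉F y∈F

        deep′ : DeepSmall E (depth w)
        deep′ u dw<du = deep u (ℕ.≤-<-trans (up-depth w↑y) dw<du)

        shed-w : Shedding F E w
        shed-w A indA F⊆A A⊆E w∈A with any? (λ x → ¬? (x ∈? A) ×-dec up? E x w)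
        ... | yes (x , x∉A , x↑w) = x , source∈ x↑w , x∉A ,
          small⇒independent (exchange-below (independent⇒small indA) A⊆E deep′ w∈A x∉A x↑w)
        ... | no full with gap (independent⇒small indA)
        ... | x , x∉A , x↑y = x , source∈ x↑y , x∉A ,
          small⇒independent (exchange-across (independent⇒small indA) A⊆E deep (F⊆A y∈F) w∈A
            x∉A w≢y w↑y′ x↑y w-full (heaviest x ((λ x∈F → x∉A (F⊆A x∈F)) , x↑y)))
          where
          -- A vertex `q` outside `A` on the way up from `w` is also outside `F` and lies strictly
          -- above `w`, so its branch would be larger than that of the heaviest choice `w`.
          w↑y′ : Up A w y
          w↑y′ with up-or-gap A w↑y
          ... | inj₁ w↑y″ = w↑y″
          ... | inj₂ (q , q∉A , w↑q , q↑y) =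
            contradiction (heaviest q ((λ q∈F → q∉A (F⊆A q∈F)) , q↑y))
              (ℕ.<⇒≱ (∣branch∣-strict w↑q λ { refl → q∉A w∈A }))

          w-full : branch E w ⊆ branch A w
          w-full z∈ with up-or-gap A (∈branch⁻ z∈)
          ... | inj₁ z↑w                 = ∈branch⁺ z↑w
          ... | inj₂ (q , q∉A , _ , q↑w) = contradiction (q , q∉A , q↑w) full

    ind-shellable : Shellable (Ind r G)
    ind-shellable = shellable hasShedding

-- Walks and simple paths in acyclic graphs.

least : ∀ {P : ℕ → Set} → Decidable P → ∀ k → P k → ∃[ m ] P m × (∀ j → P j → m ≤ j)
least P? zero    P0 = 0 , P0 , λ _ _ → z≤n
least P? (suc k) Pk with P? 0
... | yes P0 = 0 , P0 , λ _ _ → z≤n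
... | no ¬P0 with least (P? ∘ suc) k Pk
... | m , Pm , min = suc m , Pm , λ { zero P0 → contradiction P0 ¬P0 ; (suc j) Pj → s≤s (min j Pj) }

module _ {G : Graph n} where

  walk-map : ∀ {P Q : Fin n → Set} {u v k} → (∀ {z} → P z → Q z) → WalkIn G P u v k → WalkIn G Q u v k
  walk-map f (nil Pu)         = nil (f Pu)
  walk-map f (cons Pu uw walk) = cons (f Pu) uw (walk-map f walk)

  join : ∀ {P : Fin n → Set} {u v w k l} → WalkIn G P u w k → WalkIn G P v w l → ∃[ m ] WalkIn G P u v m
  join uw (nil _)          = _ , uw
  join uw (cons Pv vz zw) with join uw zw
  ... | m , uz = suc m , snoc uz (Adj-sym G vz) Pv

  -- The fields mirror the clauses of `IsCycle`, so that prepending a common neighbour of the two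
  -- ends off the path turns it into a cycle.
  record SimplePath (P : Fin n → Set) (u v : Fin n) : Set where
    constructor simplePath
    field
      tail   : List (Fin n)
      unique : Unique (u ∷ tail)
      chain  : Chain G (u ∷ tail)
      within : All P (u ∷ tail)
      ends   : last (u ∷ tail) ≡ just v

  suffix : ∀ {P : Fin n → Set} {u v w} (path : SimplePath P w v) →
    u List.∈ w ∷ SimplePath.tail path → SimplePath P u v
  suffix path (here refl) = path
  suffix (simplePath (x ∷ xs) (_ ∷ unique) (_ , chain) (_ ∷ within) ends) (there u∈) =
    suffix (simplePath xs unique chain within ends) u∈

  -- Loops are cut from the back: if `u` already occurs on the simplified rest, the part of it
  -- starting at `u` is kept.
  simplify : ∀ {P : Fin n → Set} {u v k} → WalkIn G P u v k → SimplePath P u v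
  simplify (nil Pu) = simplePath [] ([] ∷ []) tt (Pu ∷ []) refl
  simplify {u = u} (cons {w = w} Pu uw walk) with simplify walk
  ... | path@(simplePath xs unique chain within ends) with u List∈? (w ∷ xs)
    where open DecMembership _≟_ renaming (_∈?_ to _List∈?_)
  ... | yes u∈ = suffix path u∈
  ... | no  u∉ = simplePath (w ∷ xs) (All.¬Any⇒All¬ _ u∉ ∷ unique) (uw , chain) (Pu ∷ within) ends

  -- A simple path between distinct neighbours of `p` that avoids `p` would close up through `p` to
  -- a cycle.
  neighbours-separated : Acyclic G → ∀ {p u v k} → Adj G p u → Adj G p v →
    WalkIn G (_≢ p) u v k → u ≡ v
  neighbours-separated acyclic {p} {u} {v} pu pv walk with simplify walk
  ... | simplePath []       _      _     _      ends = just-injective ends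
  ... | simplePath (x ∷ xs) unique chain within ends = contradiction
    ( s≤s (s≤s (s≤s z≤n)) , All.map (_∘ ≡-sym) within ∷ unique , (pu , chain)
    , λ z eq → subst (λ q → Adj G q p) (just-injective (trans (≡-sym ends) eq)) (Adj-sym G pv) )
    (acyclic (p ∷ u ∷ x ∷ xs))

-- Rooting a tree by distance to a chosen vertex.

module BreadthFirst {n} (G : Graph n) (connected : Connected G) (acyclic : Acyclic G)
                    (root : Fin n) where

  walk? : ∀ u k → Dec (Walk G u root k)
  walk? u zero    = map′ (λ { refl → nil tt }) (λ { (nil _) → refl }) (u ≟ root)
  walk? u (suc k) = map′ (λ { (_ , uw , walk) → cons tt uw walk })
                         (λ { (cons _ uw walk) → _ , uw , walk })
                         (any? λ w → T? (adj G u w) ×-dec walk? w k)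

  shortest : ∀ u → ∃[ m ] Walk G u root m × (∀ j → Walk G u root j → m ≤ j)
  shortest u with connected u root
  ... | k , walk = least (walk? u) k walk

  dist : Fin n → ℕ
  dist u = proj₁ (shortest u)

  dist-min : ∀ {u k} → Walk G u root k → dist u ≤ k
  dist-min {u} {k} = proj₂ (proj₂ (shortest u)) k

  dist-adj : ∀ {u v} → Adj G u v → dist u ≤ suc (dist v)
  dist-adj {v = v} uv = dist-min (cons tt uv (proj₁ (proj₂ (shortest v))))

  descent : ∀ u → u ≡ root ⊎ (∃[ w ] Adj G u w × dist u ≡ suc (dist w))
  descent u with shortest u
  ... | zero  , nil _            , _   = inj₁ refl
  ... | suc m , cons _ uw walk , min = inj₂ (_ , uw , ℕ.≤-antisym
    (min _ (cons tt uw (proj₁ (proj₂ (shortest _))))) (s≤s (dist-min walk)))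

  descending-walk : ∀ u → ∃[ k ] WalkIn G (λ z → z ≡ u ⊎ dist z < dist u) u root k
  descending-walk u = go (dist u) u refl
    where
    go : ∀ m u → dist u ≡ m → ∃[ k ] WalkIn G (λ z → z ≡ u ⊎ dist z < dist u) u root k
    go m u eq with descent u
    ... | inj₁ refl = 0 , nil (inj₁ refl)
    go zero    u eq | inj₂ (w , uw , dw) with trans (≡-sym eq) dw
    ... | ()
    go (suc m) u eq | inj₂ (w , uw , dw) with go m w (ℕ.suc-injective (trans (≡-sym dw) eq))
    ... | k , walk = suc k , cons (inj₁ refl) uw (walk-map
      (λ { (inj₁ refl) → inj₂ (ℕ.≤-reflexive (≡-sym dw))
         ; (inj₂ dz<dw) → inj₂ (ℕ.<-trans dz<dw (ℕ.≤-reflexive (≡-sym dw))) }) walk)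

  -- After `u`, a shortest descent meets only vertices closer to the root than `u`, hence closer
  -- than `p`; and `u` is not `p`, since they are adjacent.
  avoiding : ∀ {p u} → Adj G p u → dist u ≤ dist p → ∃[ k ] WalkIn G (_≢ p) u root k
  avoiding {p} {u} pu du≤dp with descending-walk u
  ... | k , walk = k , walk-map
    (λ { (inj₁ refl) refl → subst T (irrefl G p) pu
       ; (inj₂ dz<du) refl → ℕ.<⇒≱ dz<du du≤dp }) walk

  -- Both neighbours reach the root without meeting `p`, so they are joined off `p` and must
  -- coincide. This gives unique parents and also, in `downhill`, excludes edges within a level.
  lower-unique : ∀ {p u v} → Adj G p u → Adj G p v → dist u ≤ dist p → dist v ≤ dist p → u ≡ v
  lower-unique pu pv du≤dp dv≤dp =
    neighbours-separated acyclic pu pv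
      (proj₂ (join (proj₂ (avoiding pu du≤dp)) (proj₂ (avoiding pv dv≤dp))))

  downhill : ∀ {u v} → Adj G u v → dist v ≤ dist u → dist u ≡ suc (dist v)
  downhill {u} {v} uv dv≤du with descent u
  ... | inj₂ (w , uw , dw) =
    trans dw (cong (suc ∘ dist) (lower-unique uw uv (ℕ.≤-trans (ℕ.n≤1+n _) (ℕ.≤-reflexive (≡-sym dw))) dv≤du))
  -- When `u` is the root, `v` also has distance 0 and would be the root, which has no loop.
  ... | inj₁ refl with descent v
  ...   | inj₁ refl = contradiction uv (subst T (irrefl G v))
  ...   | inj₂ (w , _ , dw) with subst (_≤ 0) dw (ℕ.≤-trans dv≤du (dist-min (nil tt)))
  ...     | ()

  rooting : Rooting G
  rooting = record
    { depth         = dist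
    ; edge          = λ {u} {v} uv → Sum.map
        (λ dv≤du → uv , downhill uv dv≤du)
        (λ du≤dv → Adj-sym G uv , downhill (Adj-sym G uv) du≤dv)
        (ℕ.≤-total (dist v) (dist u))
    ; parent-unique = λ { (zp , dp) (zq , dq) → lower-unique zp zq (lower dp) (lower dq) }
    }
    where
    lower : ∀ {z p} → dist z ≡ suc (dist p) → dist p ≤ dist z
    lower eq = ℕ.≤-trans (ℕ.n≤1+n _) (ℕ.≤-reflexive (≡-sym eq))

theorem4p9 : ∀ n (G : Graph n) → IsTree G → DiamLe G 5 →
    ∀ r → 2 ≤ r → Shellable (Ind r G)
theorem4p9 n G (1≤n , connected , acyclic) _ r _ =
  Forest.ind-shellable (BreadthFirst.rooting G connected acyclic (fromℕ< 1≤n)) r
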